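{- Let $n$ be a positive integer. The number of partitions of $n$ into distinct odd parts is equal to the number of partitions of $n$ into distinct positive integers, each of which is odd or a multiple of $4$, such that any two consecutive parts differ by at least $4$ and any two parts that are both multiples of $4$ differ by at least $8$.
   Context: A partition of $n$ is written $\lambda_1+\cdots+\lambda_s$ with parts in non-increasing order; consecutive parts are $\lambda_i,\lambda_{i+1}$. -}

module Defs where

open import Data.List.Base using (List; length)
open import Data.List.Membership.Propositional using (_∈_)
open import Data.List.Relation.Unary.All using (All)
open import Data.List.Relation.Unary.AllPairs using (AllPairs)
open import Data.List.Relation.Unary.Linked using (Linked)
open import Data.List.Relation.Unary.Unique.Propositional using (Unique)
open import Data.Nat.Base using (ℕ; _≤_; _≥_; _<_; _%_; ∣_-_∣)
open import Data.Nat.Divisibility using (_∣_)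
open import Data.Nat.ListAction using (sum)
open import Data.Sum.Base using (_⊎_)
open import Function.Bundles using (_⇔_)
open import Relation.Binary.PropositionalEquality using (_≡_)

Odd : ℕ → Set
Odd m = m % 2 ≡ 1

record IsPartition (n : ℕ) (parts : List ℕ) : Set where
  field
    positive      : All (0 <_) parts
    nonincreasing : Linked _≥_ parts
    sums-to       : sum parts ≡ n

record DistinctOdd (n : ℕ) (parts : List ℕ) : Set where
  field
    isPartition : IsPartition n parts
    distinct    : Unique parts
    odd         : All Odd parts

-- `Linked` relates neighbouring entries of the list, i.e. consecutive parts,
-- whereas `AllPairs` relates the entries at any two different positions.
record GapPartition (n : ℕ) (parts : List ℕ) : Set where
  field
    isPartition     : IsPartition n parts
    distinct        : Unique parts
    odd-or-4∣       : All (λ a → Odd a ⊎ 4 ∣ a) parts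
    consecutive-gap : Linked (λ a b → 4 ≤ ∣ a - b ∣) parts
    multiples-gap   : AllPairs (λ a b → 4 ∣ a → 4 ∣ b → 8 ≤ ∣ a - b ∣) parts

-- Exactly k elements of A satisfy P: they are listed without repetition, so
-- that the count does not depend on how many proofs P x has.
record HasCardinality {A : Set} (P : A → Set) (k : ℕ) : Set where
  field
    elements    : List A
    unique      : Unique elements
    enumerates  : ∀ x → x ∈ elements ⇔ P x
    cardinality : length elements ≡ k

{-# OPTIONS --safe #-}
module Submission where

-- This is the case of modulus 4 of the generalisation of Schur's 1926 theorem
-- to an arbitrary modulus. The proof is Andrews's q-series method, arranged so
-- that no subtraction occurs.
--
-- Give an odd part weight 1 and a multiple of 4 weight 2, and let the
-- variable x record the total weight. Let G_N(x) be the generating function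
-- of the gap partitions with all parts at most N, with G_N = 1 for N <= 0.
-- Removing a largest part gives
--   G_{4k+1} = G_{4k}   + x   q^{4k+1} G_{4k-3},
--   G_{4k+3} = G_{4k+1} + x   q^{4k+3} G_{4k-1},
--   G_{4k+4} = G_{4k+3} + x^2 q^{4k+4} G_{4k-1};
-- in the last line the parts 4k+4 and 4k are too close, which is why the
-- index drops to 4k-1. With P = (1 + x q)(1 + x q^3) the key identity is
--   G_{4k+4}(x) = P G_{4k-1}(x q^4)                     (twoSmallest-gap₃),
-- and it is proved by induction on k together with
--   P G_{4k}(x q^4)   = G_{4k+4}(x) + x^2 q^{4k+8} G_{4k}(x)    for k >= 1,
--   P G_{4k+1}(x q^4) = G_{4k+5}(x) + x^2 q^{4k+8} G_{4k+1}(x)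
-- (twoSmallest-gap₄ and twoSmallest-gap₁).
-- The generating function of partitions into distinct odd parts satisfies the
-- same functional equation, since replacing x by x q^4 raises every part by 4
-- and so leaves out exactly the parts 1 and 3 (odds-twoSmallest). In bounded
-- degree in q, for large enough k, G_{4k-1} and G_{4k} are interchangeable, and
-- iterating the functional equation identifies the two generating functions
-- (gap₄≡odds).
--
-- The variable x only ever needs to take the values q^{4m}, so it is replaced
-- by the parameter m: an odd part a then counts as a + 4m, and a multiple a of
-- 4 counts as a + 8m. A power series is represented by the linear functionals
-- that it induces: for a fixed φ, the series F = sum of c_j q^j becomes the
-- function sending s to the sum of c_j φ(s + j), so that multiplication by
-- q^j is the shift of s by j and every identity is one in the semiring of
-- natural numbers.
--
-- Finally, both families are listed explicitly by the same recursions
-- (enumerate-gap₄, enumerate-odd, total-gap₄, total-odd), and φ is taken to be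
-- the indicator of n.

open import Defs
open import Algebra.Properties.CommutativeSemigroup
  using (xy∙z≈xz∙y) renaming (interchange to interchange′)
open import Data.Bool.Base using (true; false; if_then_else_)
open import Data.List.Base using (List; []; _∷_; _++_; map; filter; length)
open import Data.List.Membership.Propositional using (_∈_)
open import Data.List.Membership.Propositional.Properties
  using (∈-++⁺ˡ; ∈-++⁺ʳ; ∈-++⁻; ∈-map⁺; ∈-map⁻; ∈-filter⁺; ∈-filter⁻)
open import Data.List.Properties using (map-++; map-∘; map-cong; ∷-injectiveʳ)
open import Data.List.Relation.Unary.All as All using (All; []; _∷_)
open import Data.List.Relation.Unary.AllPairs as AllPairs using (AllPairs; []; _∷_)
open import Data.List.Relation.Unary.Any using (here)
open import Data.List.Relation.Unary.Linked as Linked using ()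
open import Data.List.Relation.Unary.Linked.Properties
  using (AllPairs⇒Linked; Linked⇒AllPairs)
open import Data.List.Relation.Unary.Unique.Propositional using (Unique)
import Data.List.Relation.Unary.Unique.Propositional.Properties as Unique
open import Data.Nat.Base
open import Data.Nat.DivMod using ([m+kn]%n≡m%n; m*n%n≡0)
open import Data.Nat.Divisibility
  using (_∣_; divides; n∣m*n; ∣⇒≤; ∣-refl; ∣m+n∣m⇒∣n)
open import Data.Nat.ListAction using (sum)
open import Data.Nat.ListAction.Properties using (sum-++)
open import Data.Nat.Properties
open import Data.Nat.Tactic.RingSolver using (solve-∀)
open import Data.Product.Base using (∃-syntax; _×_; _,_; proj₁; proj₂)
open import Data.Sum.Base using (_⊎_; inj₁; inj₂)
open import Function.Base using (_∘_)
open import Function.Bundles using (mk⇔)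
open import Relation.Binary.PropositionalEquality
open import Relation.Nullary.Decidable using (does; dec-false)
open import Relation.Nullary.Negation using (¬_; contradiction)

-- Multiplication by (1 + x q)(1 + x q^3)

interchange : ∀ a b c d → (a + b) + (c + d) ≡ (a + c) + (b + d)
interchange = interchange′ +-commutativeSemigroup

-- Multiplication of the series F by (1 + x q)(1 + x q^3) at x = q^{4m}: the
-- parts 1 and 3, which count as 1 + 4m and 3 + 4m, are each adjoined or not.
withTwoSmallest : ℕ → (ℕ → ℕ) → ℕ → ℕ
withTwoSmallest m F s =
  (F s + F (s + (1 + m * 4))) + (F (s + (3 + m * 4)) + F (s + (4 + m * 8)))

withTwoSmallest-cong : ∀ m {F G : ℕ → ℕ} → (∀ s → F s ≡ G s) →
  ∀ s → withTwoSmallest m F s ≡ withTwoSmallest m G s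
withTwoSmallest-cong m F≗G s =
  cong₂ _+_ (cong₂ _+_ (F≗G _) (F≗G _)) (cong₂ _+_ (F≗G _) (F≗G _))

-- Linearity over series: F + q^c G is multiplied termwise.
withTwoSmallest-+ : ∀ m (F G : ℕ → ℕ) c s →
  withTwoSmallest m (λ u → F u + G (u + c)) s
    ≡ withTwoSmallest m F s + withTwoSmallest m G (s + c)
withTwoSmallest-+ m F G c s = begin
  withTwoSmallest m (λ u → F u + G (u + c)) s
    ≡⟨ cong₂ _+_ (interchange (F s) _ _ _) (interchange (F (s + c₃)) _ _ _) ⟩
  ((F s + F (s + c₁)) + (G (s + c) + G (s + c₁ + c)))
    + ((F (s + c₃) + F (s + c₄)) + (G (s + c₃ + c) + G (s + c₄ + c)))
    ≡⟨ interchange (F s + F (s + c₁)) _ _ _ ⟩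
  withTwoSmallest m F s
    + ((G (s + c) + G (s + c₁ + c)) + (G (s + c₃ + c) + G (s + c₄ + c)))
    ≡⟨ cong (withTwoSmallest m F s +_) (cong₂ _+_
         (cong (λ i → G (s + c) + G i) (swap c₁))
         (cong₂ (λ i j → G i + G j) (swap c₃) (swap c₄))) ⟩
  withTwoSmallest m F s + withTwoSmallest m G (s + c) ∎
  where
  open ≡-Reasoning
  c₁ = 1 + m * 4
  c₃ = 3 + m * 4
  c₄ = 4 + m * 8
  swap : ∀ a → (s + a) + c ≡ (s + c) + a
  swap a = xy∙z≈xz∙y +-commutativeSemigroup s a c

-- Generating functions and their functional equations

module Weighted (φ : ℕ → ℕ) where

  -- Partitions into distinct parts from the k odd numbers 2t+1, 2t+3, ...,
  -- 2(t+k)-1, built by deciding on the largest part first.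
  odds : ℕ → ℕ → ℕ → ℕ
  odds t zero    s = φ s
  odds t (suc k) s = odds t k s + odds t k (s + (1 + (t + k) * 2))

  -- The same series, built by deciding on the smallest part 2t+1 first.
  odds-smallest : ∀ t k s →
    odds t (suc k) s ≡ odds (suc t) k s + odds (suc t) k (s + (1 + t * 2))
  odds-smallest t zero s = cong (λ i → φ s + φ (s + (1 + i * 2))) (+-identityʳ t)
  odds-smallest t (suc k) s = begin
    odds t (suc k) s + odds t (suc k) (s + (1 + (t + suc k) * 2))
      ≡⟨ cong₂ _+_ (odds-smallest t k _) (odds-smallest t k _) ⟩
    (F s + F (s + (1 + t * 2)))
      + (F (s + (1 + (t + suc k) * 2)) + F ((s + (1 + (t + suc k) * 2)) + (1 + t * 2)))
      ≡⟨ cong₂ (λ i j → (F s + F (s + (1 + t * 2))) + (F i + F j)) (reindex₁ s t k) (reindex₂ s t k) ⟩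
    (F s + F (s + (1 + t * 2)))
      + (F (s + (1 + (suc t + k) * 2)) + F ((s + (1 + t * 2)) + (1 + (suc t + k) * 2)))
      ≡⟨ interchange (F s) _ _ _ ⟩
    odds (suc t) (suc k) s + odds (suc t) (suc k) (s + (1 + t * 2)) ∎
    where
    open ≡-Reasoning
    F = odds (suc t) k
    reindex₁ : ∀ s t k → s + (1 + (t + suc k) * 2) ≡ s + (1 + (suc t + k) * 2)
    reindex₁ = solve-∀
    reindex₂ : ∀ s t k → (s + (1 + (t + suc k) * 2)) + (1 + t * 2)
                       ≡ (s + (1 + t * 2)) + (1 + (suc t + k) * 2)
    reindex₂ = solve-∀

  -- With t = 2m, the two smallest parts are 4m+1 and 4m+3, and the remaining
  -- parts start at 4(m+1)+1.
  odds-twoSmallest : ∀ m k s →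
    odds (m * 2) (suc k * 2) s ≡ withTwoSmallest m (odds (suc m * 2) (k * 2)) s
  odds-twoSmallest m k s = begin
    odds (m * 2) (suc k * 2) s
      ≡⟨ odds-smallest (m * 2) (suc (k * 2)) s ⟩
    odds (suc (m * 2)) (suc (k * 2)) s + odds (suc (m * 2)) (suc (k * 2)) (s + (1 + m * 2 * 2))
      ≡⟨ cong₂ _+_ (odds-smallest (suc (m * 2)) (k * 2) _) (odds-smallest (suc (m * 2)) (k * 2) _) ⟩
    (F s + F (s + (1 + suc (m * 2) * 2)))
      + (F (s + (1 + m * 2 * 2)) + F ((s + (1 + m * 2 * 2)) + (1 + suc (m * 2) * 2)))
      ≡⟨ cong₂ _+_ (cong (λ i → F s + F i) (reindex₃ s m))
                   (cong₂ (λ i j → F i + F j) (reindex₁ s m) (reindex₄ s m)) ⟩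
    (F s + F (s + (3 + m * 4))) + (F (s + (1 + m * 4)) + F (s + (4 + m * 8)))
      ≡⟨ interchange (F s) _ _ _ ⟩
    withTwoSmallest m F s ∎
    where
    open ≡-Reasoning
    F = odds (suc m * 2) (k * 2)
    reindex₁ : ∀ s m → s + (1 + m * 2 * 2) ≡ s + (1 + m * 4)
    reindex₁ = solve-∀
    reindex₃ : ∀ s m → s + (1 + suc (m * 2) * 2) ≡ s + (3 + m * 4)
    reindex₃ = solve-∀
    reindex₄ : ∀ s m → (s + (1 + m * 2 * 2)) + (1 + suc (m * 2) * 2) ≡ s + (4 + m * 8)
    reindex₄ = solve-∀

  -- The gap partitions with all parts at most 4k-3, 4k-1 and 4k respectively,
  -- at x = q^{4m}: in terms of the series above, these are G_{4k-3}, G_{4k-1}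
  -- and G_{4k}. Each is built by deciding on its largest admissible part.
  mutual

    gap₁ : ℕ → ℕ → ℕ → ℕ
    gap₁ m zero    s = φ s
    gap₁ m (suc k) s = gap₄ m k s + gap₁ m k (s + (1 + (m + k) * 4))

    gap₃ : ℕ → ℕ → ℕ → ℕ
    gap₃ m zero    s = φ s
    gap₃ m (suc k) s = gap₁ m (suc k) s + gap₃ m k (s + (3 + (m + k) * 4))

    gap₄ : ℕ → ℕ → ℕ → ℕ
    gap₄ m zero    s = φ s
    gap₄ m (suc k) s = gap₃ m (suc k) s + gap₃ m k (s + (m * 8 + suc k * 4))

  -- Stated relative to two instances of the key identity, because its use in
  -- the induction below is at an index that has not yet decreased.
  twoSmallest-gap₄ : ∀ m k →
    (∀ s → withTwoSmallest m (gap₃ (suc m) k) s ≡ gap₄ m (suc k) s) →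
    (∀ s → withTwoSmallest m (gap₃ (suc m) (suc k)) s ≡ gap₄ m (2 + k) s) →
    ∀ s → withTwoSmallest m (gap₄ (suc m) (suc k)) s
      ≡ gap₄ m (2 + k) s + gap₄ m (suc k) (s + (m * 8 + (3 + k) * 4))
  twoSmallest-gap₄ m k eq eq⁺ s = begin
    withTwoSmallest m (gap₄ (suc m) (suc k)) s
      ≡⟨ withTwoSmallest-+ m (gap₃ (suc m) (suc k)) (gap₃ (suc m) k) c s ⟩
    withTwoSmallest m (gap₃ (suc m) (suc k)) s + withTwoSmallest m (gap₃ (suc m) k) (s + c)
      ≡⟨ cong₂ _+_ (eq⁺ s) (eq (s + c)) ⟩
    gap₄ m (2 + k) s + gap₄ m (suc k) (s + c)
      ≡⟨ cong (λ i → gap₄ m (2 + k) s + gap₄ m (suc k) i) (reindex s m k) ⟩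
    gap₄ m (2 + k) s + gap₄ m (suc k) (s + (m * 8 + (3 + k) * 4)) ∎
    where
    open ≡-Reasoning
    c = suc m * 8 + suc k * 4
    reindex : ∀ s m k → s + (suc m * 8 + suc k * 4) ≡ s + (m * 8 + (3 + k) * 4)
    reindex = solve-∀

  mutual

    -- The key identity G_{4k+4}(x) = P G_{4k-1}(x q^4).
    twoSmallest-gap₃ : ∀ m k s →
      withTwoSmallest m (gap₃ (suc m) k) s ≡ gap₄ m (suc k) s
    twoSmallest-gap₃ m zero s
      rewrite +-identityʳ m | +-comm (m * 8) 4 = sym (+-assoc (φ s + _) _ _)
    twoSmallest-gap₃ m (suc k) s = begin
      withTwoSmallest m (gap₃ (suc m) (suc k)) s
        ≡⟨ withTwoSmallest-+ m (gap₁ (suc m) (suc k)) (gap₃ (suc m) k) c s ⟩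
      withTwoSmallest m (gap₁ (suc m) (suc k)) s + withTwoSmallest m (gap₃ (suc m) k) (s + c)
        ≡⟨ cong₂ _+_ (twoSmallest-gap₁ m k s) (twoSmallest-gap₃ m k (s + c)) ⟩
      (gap₁ m (2 + k) s + gap₁ m (suc k) (s + (m * 8 + (2 + k) * 4)))
        + (gap₃ m (suc k) (s + c) + gap₃ m k (s + c + (m * 8 + suc k * 4)))
        ≡⟨ cong₂ (λ i j → (gap₁ m (2 + k) s + gap₁ m (suc k) (s + (m * 8 + (2 + k) * 4)))
                          + (gap₃ m (suc k) i + gap₃ m k j)) (reindex₁ s m k) (reindex₂ s m k) ⟩
      (gap₁ m (2 + k) s + gap₁ m (suc k) (s + (m * 8 + (2 + k) * 4)))
        + (gap₃ m (suc k) (s + (3 + (m + suc k) * 4))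
          + gap₃ m k (s + (m * 8 + (2 + k) * 4) + (3 + (m + k) * 4)))
        ≡⟨ interchange (gap₁ m (2 + k) s) _ _ _ ⟩
      gap₄ m (2 + k) s ∎
      where
      open ≡-Reasoning
      c = 3 + (suc m + k) * 4
      reindex₁ : ∀ s m k → s + (3 + (suc m + k) * 4) ≡ s + (3 + (m + suc k) * 4)
      reindex₁ = solve-∀
      reindex₂ : ∀ s m k → s + (3 + (suc m + k) * 4) + (m * 8 + suc k * 4)
                         ≡ s + (m * 8 + (2 + k) * 4) + (3 + (m + k) * 4)
      reindex₂ = solve-∀

    -- The identity for G_{4k+1}. It fails for k = -1, where the series is the
    -- constant 1, so the induction starts with G_1.
    twoSmallest-gap₁ : ∀ m k s →
      withTwoSmallest m (gap₁ (suc m) (suc k)) s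
        ≡ gap₁ m (2 + k) s + gap₁ m (suc k) (s + (m * 8 + (2 + k) * 4))
    -- Here G_1(x q^4) = 1 + x q^5, and both sides equal (1 + x q^5) G_4(x),
    -- since G_4 = P.
    twoSmallest-gap₁ m zero s = begin
      withTwoSmallest m (gap₁ (suc m) 1) s
        ≡⟨ withTwoSmallest-+ m φ φ c s ⟩
      withTwoSmallest m φ s + withTwoSmallest m φ (s + c)
        ≡⟨ cong₂ _+_ (twoSmallest-gap₃ m zero s) refl ⟩
      gap₄ m 1 s + ((φ (s + c) + φ (s + c + (1 + m * 4)))
                  + (φ (s + c + (3 + m * 4)) + φ (s + c + (4 + m * 8))))
        ≡⟨ cong (gap₄ m 1 s +_) (cong₂ _+_
             (cong₂ (λ i j → φ i + φ j) (reindex₁ s m) (reindex₂ s m))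
             (cong₂ (λ i j → φ i + φ j) (reindex₃ s m) (reindex₄ s m))) ⟩
      gap₄ m 1 s + (gap₁ m 1 (s + (1 + (m + 1) * 4)) + gap₁ m 1 (s + (m * 8 + 8)))
        ≡⟨ sym (+-assoc (gap₄ m 1 s) _ _) ⟩
      gap₁ m 2 s + gap₁ m 1 (s + (m * 8 + 8)) ∎
      where
      open ≡-Reasoning
      c = 1 + (suc m + 0) * 4
      reindex₁ : ∀ s m → s + (1 + (suc m + 0) * 4) ≡ s + (1 + (m + 1) * 4)
      reindex₁ = solve-∀
      reindex₂ : ∀ s m → s + (1 + (suc m + 0) * 4) + (1 + m * 4)
                       ≡ s + (1 + (m + 1) * 4) + (1 + (m + 0) * 4)
      reindex₂ = solve-∀
      reindex₃ : ∀ s m → s + (1 + (suc m + 0) * 4) + (3 + m * 4) ≡ s + (m * 8 + 8)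
      reindex₃ = solve-∀
      reindex₄ : ∀ s m → s + (1 + (suc m + 0) * 4) + (4 + m * 8)
                       ≡ s + (m * 8 + 8) + (1 + (m + 0) * 4)
      reindex₄ = solve-∀
    twoSmallest-gap₁ m (suc k) s = begin
      withTwoSmallest m (gap₁ (suc m) (2 + k)) s
        ≡⟨ withTwoSmallest-+ m (gap₄ (suc m) (suc k)) (gap₁ (suc m) (suc k)) c s ⟩
      withTwoSmallest m (gap₄ (suc m) (suc k)) s + withTwoSmallest m (gap₁ (suc m) (suc k)) (s + c)
        ≡⟨ cong₂ _+_
             (twoSmallest-gap₄ m k (twoSmallest-gap₃ m k) (twoSmallest-gap₃ m (suc k)) s)
             (twoSmallest-gap₁ m k (s + c)) ⟩
      (gap₄ m (2 + k) s + gap₄ m (suc k) (s + (m * 8 + (3 + k) * 4)))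
        + (gap₁ m (2 + k) (s + c) + gap₁ m (suc k) (s + c + (m * 8 + (2 + k) * 4)))
        ≡⟨ cong₂ (λ i j → (gap₄ m (2 + k) s + gap₄ m (suc k) (s + (m * 8 + (3 + k) * 4)))
                          + (gap₁ m (2 + k) i + gap₁ m (suc k) j)) (reindex₁ s m k) (reindex₂ s m k) ⟩
      (gap₄ m (2 + k) s + gap₄ m (suc k) (s + (m * 8 + (3 + k) * 4)))
        + (gap₁ m (2 + k) (s + (1 + (m + (2 + k)) * 4))
          + gap₁ m (suc k) (s + (m * 8 + (3 + k) * 4) + (1 + (m + suc k) * 4)))
        ≡⟨ interchange (gap₄ m (2 + k) s) _ _ _ ⟩
      gap₁ m (3 + k) s + gap₁ m (2 + k) (s + (m * 8 + (3 + k) * 4)) ∎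
      where
      open ≡-Reasoning
      c = 1 + (suc m + suc k) * 4
      reindex₁ : ∀ s m k → s + (1 + (suc m + suc k) * 4) ≡ s + (1 + (m + (2 + k)) * 4)
      reindex₁ = solve-∀
      reindex₂ : ∀ s m k → s + (1 + (suc m + suc k) * 4) + (m * 8 + (2 + k) * 4)
                         ≡ s + (m * 8 + (3 + k) * 4) + (1 + (m + suc k) * 4)
      reindex₂ = solve-∀

  -- Truncation: when φ vanishes from bound on, only the coefficients of q^j
  -- with s + j < bound matter.
  module Vanishing (bound : ℕ) (vanish : ∀ {s} → bound ≤ s → φ s ≡ 0) where

    mutual

      gap₁-vanish : ∀ m k {s} → bound ≤ s → gap₁ m k s ≡ 0
      gap₁-vanish m zero    b≤s = vanish b≤s
      gap₁-vanish m (suc k) b≤s =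
        cong₂ _+_ (gap₄-vanish m k b≤s) (gap₁-vanish m k (≤-trans b≤s (m≤m+n _ _)))

      gap₃-vanish : ∀ m k {s} → bound ≤ s → gap₃ m k s ≡ 0
      gap₃-vanish m zero    b≤s = vanish b≤s
      gap₃-vanish m (suc k) b≤s =
        cong₂ _+_ (gap₁-vanish m (suc k) b≤s) (gap₃-vanish m k (≤-trans b≤s (m≤m+n _ _)))

      gap₄-vanish : ∀ m k {s} → bound ≤ s → gap₄ m k s ≡ 0
      gap₄-vanish m zero    b≤s = vanish b≤s
      gap₄-vanish m (suc k) b≤s =
        cong₂ _+_ (gap₃-vanish m (suc k) b≤s) (gap₃-vanish m k (≤-trans b≤s (m≤m+n _ _)))

    -- The partitions with largest part 4k, which make the difference, count as at
    -- least 8(m+1) + 4k, and this is not below the bound.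
    gap₃≡gap₄ : ∀ m k → bound ≤ suc (m + k) * 4 → ∀ s → gap₃ (suc m) k s ≡ gap₄ (suc m) k s
    gap₃≡gap₄ m zero    b≤ s = refl
    gap₃≡gap₄ m (suc k) b≤ s = begin
      gap₃ (suc m) (suc k) s
        ≡⟨ +-identityʳ _ ⟨
      gap₃ (suc m) (suc k) s + 0
        ≡⟨ cong (gap₃ (suc m) (suc k) s +_) (gap₃-vanish (suc m) k b≤part) ⟨
      gap₄ (suc m) (suc k) s ∎
      where
      open ≡-Reasoning
      excess : ∀ s m k → s + (suc m * 8 + suc k * 4) ≡ suc (m + suc k) * 4 + (s + suc m * 4)
      excess = solve-∀
      b≤part : bound ≤ s + (suc m * 8 + suc k * 4)
      b≤part = subst (bound ≤_) (sym (excess s m k)) (≤-trans b≤ (m≤m+n _ _))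

    -- Each use of the functional equation raises m and lowers k by one, so that
    -- the hypothesis on m + k is preserved; the recursion ends with both series
    -- equal to 1.
    gap₄≡odds : ∀ m k → bound ≤ (m + k) * 4 → ∀ s → gap₄ m k s ≡ odds (m * 2) (k * 2) s
    gap₄≡odds m zero    b≤ s = refl
    gap₄≡odds m (suc k) b≤ s = begin
      gap₄ m (suc k) s
        ≡⟨ twoSmallest-gap₃ m k s ⟨
      withTwoSmallest m (gap₃ (suc m) k) s
        ≡⟨ withTwoSmallest-cong m
             (λ u → trans (gap₃≡gap₄ m k b≤′ u) (gap₄≡odds (suc m) k b≤′ u)) s ⟩
      withTwoSmallest m (odds (suc m * 2) (k * 2)) s
        ≡⟨ odds-twoSmallest m k s ⟨
      odds (m * 2) (suc k * 2) s ∎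
      where
      open ≡-Reasoning
      b≤′ : bound ≤ suc (m + k) * 4
      b≤′ = subst (λ i → bound ≤ i * 4) (+-suc m k) b≤

-- Explicit lists of partitions

-- The list xs contains exactly the elements satisfying P, each once.
record Enumerates {A : Set} (P : A → Set) (xs : List A) : Set where
  field
    unique   : Unique xs
    sound    : ∀ {x} → x ∈ xs → P x
    complete : ∀ {x} → P x → x ∈ xs

-- Lists of numbers satisfying Part in which every entry a is followed only by
-- entries below next a. For distinct odd parts, next a is a itself; for gap partitions it
-- depends on the parity of a, which brings all the gap conditions into this form.
module DescendingLists (Part : ℕ → Set) (next : ℕ → ℕ) (next≤ : ∀ a → next a ≤ a) where

  -- The bound N on the entries is strict.
  record Descending (N : ℕ) (l : List ℕ) : Set where
    constructor descending
    field
      parts   : All Part l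
      bounded : All (_< N) l
      gaps    : AllPairs (λ a b → b < next a) l

  weaken : ∀ {M N l} → M ≤ N → Descending M l → Descending N l
  weaken M≤N (descending ps bs gs) =
    descending ps (All.map (λ b → <-≤-trans b M≤N) bs) gs

  cons : ∀ {N t} → Part N → Descending (next N) t → Descending (suc N) (N ∷ t)
  cons {N} p (descending ps bs gs) =
    descending (p ∷ ps) (≤-refl ∷ All.map (λ b → m≤n⇒m≤1+n (<-≤-trans b (next≤ N))) bs) (bs ∷ gs)

  -- A list with entries below N + 1 either has entries below N, or begins with N,
  -- and then its tail has entries below next N.
  uncons : ∀ {N l} → Descending (suc N) l →
    Descending N l ⊎ ∃[ t ] (l ≡ N ∷ t × Part N × Descending (next N) t)
  uncons (descending [] [] []) = inj₁ (descending [] [] [])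
  uncons (descending (p ∷ ps) (b ∷ _) (g ∷ gs)) with m<1+n⇒m<n∨m≡n b
  ... | inj₂ refl = inj₂ (_ , refl , p , descending ps g gs)
  ... | inj₁ h<N  = inj₁ (descending (p ∷ ps)
    (h<N ∷ All.map (λ b<h → <-trans (<-≤-trans b<h (next≤ _)) h<N) g) (g ∷ gs))

  enumerate-empty : Enumerates (Descending 0) ([] ∷ [])
  enumerate-empty = record
    { unique   = [] ∷ []
    ; sound    = λ { (here refl) → descending [] [] [] }
    ; complete = λ { (descending [] [] []) → here refl }
    }

  enumerate-skip : ∀ {N L} → ¬ Part N →
    Enumerates (Descending N) L → Enumerates (Descending (suc N)) L
  enumerate-skip {N} {L} ¬p E = record
    { unique   = unique
    ; sound    = weaken (n≤1+n N) ∘ sound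
    ; complete = complete′ ∘ uncons
    }
    where
    open Enumerates E
    complete′ : ∀ {l} → Descending N l ⊎ ∃[ t ] (l ≡ N ∷ t × Part N × Descending (next N) t) → l ∈ L
    complete′ (inj₁ d)               = complete d
    complete′ (inj₂ (_ , _ , p , _)) = contradiction p ¬p

  enumerate-extend : ∀ {N L T} → Part N →
    Enumerates (Descending N) L → Enumerates (Descending (next N)) T →
    Enumerates (Descending (suc N)) (L ++ map (N ∷_) T)
  enumerate-extend {N} {L} {T} p EL ET = record
    { unique   = Unique.++⁺ EL.unique (Unique.map⁺ ∷-injectiveʳ ET.unique) disjoint
    ; sound    = sound′ ∘ ∈-++⁻ L
    ; complete = complete′ ∘ uncons
    }
    where
    module EL = Enumerates EL
    module ET = Enumerates ET
    disjoint : ∀ {l} → ¬ (l ∈ L × l ∈ map (N ∷_) T)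
    disjoint (l∈L , l∈T) with ∈-map⁻ (N ∷_) l∈T | EL.sound l∈L
    ... | _ , _ , refl | descending _ (N<N ∷ _) _ = n≮n N N<N
    sound′ : ∀ {l} → l ∈ L ⊎ l ∈ map (N ∷_) T → Descending (suc N) l
    sound′ (inj₁ l∈L) = weaken (n≤1+n N) (EL.sound l∈L)
    sound′ (inj₂ l∈T) with ∈-map⁻ (N ∷_) l∈T
    ... | _ , t∈T , refl = cons p (ET.sound t∈T)
    complete′ : ∀ {l} → Descending N l ⊎ ∃[ t ] (l ≡ N ∷ t × Part N × Descending (next N) t) →
      l ∈ L ++ map (N ∷_) T
    complete′ (inj₁ d)                  = ∈-++⁺ˡ (EL.complete d)
    complete′ (inj₂ (_ , refl , _ , d)) = ∈-++⁺ʳ L (∈-map⁺ (N ∷_) (ET.complete d))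

-- If Q is the conjunction of P with having sum n, then the lists satisfying Q are
-- counted by filtering a list that enumerates P.
enumerate-filter : ∀ {n L} {P Q : List ℕ → Set} → Enumerates P L →
  (∀ {l} → Q l → P l × sum l ≡ n) → (∀ {l} → P l → sum l ≡ n → Q l) →
  HasCardinality Q (length (filter (λ l → sum l ≟ n) L))
enumerate-filter {n} E to from = record
  { elements    = _
  ; unique      = Unique.filter⁺ sum≟ unique
  ; enumerates  = λ _ → mk⇔
      (λ l∈ → let l∈L , eq = ∈-filter⁻ sum≟ l∈ in from (sound l∈L) eq)
      (λ q → let p , eq = to q in ∈-filter⁺ sum≟ (complete p) eq)
  ; cardinality = refl
  }
  where
  open Enumerates E
  sum≟ = λ l → sum l ≟ n

-- Partitions into distinct odd parts

-- The partitions into distinct odd parts below 2k.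
oddLists : ℕ → List (List ℕ)
oddLists zero    = [] ∷ []
oddLists (suc k) = oddLists k ++ map ((1 + k * 2) ∷_) (oddLists k)

module OddParts = DescendingLists Odd (λ a → a) (λ _ → ≤-refl)

enumerate-odd : ∀ k → Enumerates (OddParts.Descending (k * 2)) (oddLists k)
enumerate-odd zero    = OddParts.enumerate-empty
enumerate-odd (suc k) = OddParts.enumerate-extend ([m+kn]%n≡m%n 1 k 2) skipped skipped
  where
  skipped = OddParts.enumerate-skip
    (λ odd → contradiction (trans (sym odd) (m*n%n≡0 k 2)) λ ()) (enumerate-odd k)

parts≤sum : ∀ l → All (_≤ sum l) l
parts≤sum []      = []
parts≤sum (a ∷ l) = m≤m+n a (sum l) ∷ All.map (m≤n⇒m≤o+n a) (parts≤sum l)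

sum<⇒parts< : ∀ {n N l} → sum l ≡ n → n < N → All (_< N) l
sum<⇒parts< {l = l} refl n<N = All.map (λ a≤n → ≤-<-trans a≤n n<N) (parts≤sum l)

distinctOdd⇒descending : ∀ {n N l} → n < N → DistinctOdd n l → OddParts.Descending N l × sum l ≡ n
distinctOdd⇒descending n<N d =
  OddParts.descending odd
    (sum<⇒parts< sums-to n<N)
    (AllPairs.zipWith (λ (a≥b , a≢b) → ≤∧≢⇒< a≥b (a≢b ∘ sym))
      (Linked⇒AllPairs (λ a≥b b≥c → ≤-trans b≥c a≥b) nonincreasing , distinct))
  , sums-to
  where
  open DistinctOdd d
  open IsPartition isPartition

odd-positive : ∀ {a} → Odd a → 0 < a
odd-positive {suc _} _ = z<s

descending⇒distinctOdd : ∀ {n N l} → OddParts.Descending N l → sum l ≡ n → DistinctOdd n l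
descending⇒distinctOdd (OddParts.descending ps _ gs) eq = record
  { isPartition = record
    { positive      = All.map odd-positive ps
    ; nonincreasing = AllPairs⇒Linked (AllPairs.map <⇒≤ gs)
    ; sums-to       = eq
    }
  ; distinct = AllPairs.map >⇒≢ gs
  ; odd      = ps
  }

-- Gap partitions

-- The strict bound on the parts after a: below a - 3 if a is odd, and below
-- a - 4 if a is a multiple of 4, since a difference of exactly 4 would then make
-- the later part a multiple of 4 at distance less than 8. Truncated subtraction is
-- harmless: no part can follow a part that is at most 4, and the bound is then 0.
nextGap : ℕ → ℕ
nextGap a = a ∸ (4 ∸ a % 2)

GapPart : ℕ → Set
GapPart a = 0 < a × (Odd a ⊎ 4 ∣ a)

nextGap-odd : ∀ a → Odd a → nextGap a ≡ a ∸ 3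
nextGap-odd a odd = cong (λ r → a ∸ (4 ∸ r)) odd

4∣⇒%2≡0 : ∀ {a} → 4 ∣ a → a % 2 ≡ 0
4∣⇒%2≡0 (divides q refl) = trans (cong (_% 2) (sym (*-assoc q 2 2))) (m*n%n≡0 (q * 2) 2)

nextGap-4∣ : ∀ a → 4 ∣ a → nextGap a ≡ a ∸ 4
nextGap-4∣ a 4∣a = cong (λ r → a ∸ (4 ∸ r)) (4∣⇒%2≡0 4∣a)

module GapParts = DescendingLists GapPart nextGap (λ a → m∸n≤m a (4 ∸ a % 2))

-- The gap partitions with all parts at most 4k-3, 4k-1 and 4k, following the
-- recursions of gap₁, gap₃ and gap₄ at m = 0.
mutual

  gapLists₁ : ℕ → List (List ℕ)
  gapLists₁ zero    = [] ∷ []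
  gapLists₁ (suc k) = gapLists₄ k ++ map ((1 + k * 4) ∷_) (gapLists₁ k)

  gapLists₃ : ℕ → List (List ℕ)
  gapLists₃ zero    = [] ∷ []
  gapLists₃ (suc k) = gapLists₁ (suc k) ++ map ((3 + k * 4) ∷_) (gapLists₃ k)

  gapLists₄ : ℕ → List (List ℕ)
  gapLists₄ zero    = [] ∷ []
  gapLists₄ (suc k) = gapLists₃ (suc k) ++ map ((suc k * 4) ∷_) (gapLists₃ k)

[r+k*4]%2 : ∀ r k → (r + k * 4) % 2 ≡ r % 2
[r+k*4]%2 r k = trans (cong (λ i → (r + i) % 2) (sym (*-assoc k 2 2))) ([m+kn]%n≡m%n r (k * 2) 2)

¬gapPart-2 : ∀ k → ¬ GapPart (2 + k * 4)
¬gapPart-2 k (_ , inj₁ odd) = contradiction (trans (sym odd) ([r+k*4]%2 2 k)) λ ()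
¬gapPart-2 k (_ , inj₂ 4∣)  =
  contradiction (∣⇒≤ (∣m+n∣m⇒∣n (subst (4 ∣_) (+-comm 2 (k * 4)) 4∣) (n∣m*n k))) λ { (s≤s (s≤s ())) }

mutual

  enumerate-gap₁ : ∀ k → Enumerates (GapParts.Descending (k * 4 ∸ 2)) (gapLists₁ k)
  enumerate-gap₁ zero    = GapParts.enumerate-empty
  enumerate-gap₁ (suc k) = GapParts.enumerate-extend (z<s , inj₁ odd) (enumerate-gap₄ k)
    (subst (λ N → Enumerates (GapParts.Descending N) (gapLists₁ k))
      (sym (nextGap-odd (1 + k * 4) odd)) (enumerate-gap₁ k))
    where odd = [r+k*4]%2 1 k

  enumerate-gap₃ : ∀ k → Enumerates (GapParts.Descending (k * 4)) (gapLists₃ k)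
  enumerate-gap₃ zero    = GapParts.enumerate-empty
  enumerate-gap₃ (suc k) = GapParts.enumerate-extend (z<s , inj₁ odd)
    (GapParts.enumerate-skip (¬gapPart-2 k) (enumerate-gap₁ (suc k)))
    (subst (λ N → Enumerates (GapParts.Descending N) (gapLists₃ k))
      (sym (nextGap-odd (3 + k * 4) odd)) (enumerate-gap₃ k))
    where odd = [r+k*4]%2 3 k

  enumerate-gap₄ : ∀ k → Enumerates (GapParts.Descending (1 + k * 4)) (gapLists₄ k)
  enumerate-gap₄ zero    = GapParts.enumerate-skip (λ ()) GapParts.enumerate-empty
  enumerate-gap₄ (suc k) = GapParts.enumerate-extend (z<s , inj₂ (n∣m*n (suc k)))
    (enumerate-gap₃ (suc k))
    (subst (λ N → Enumerates (GapParts.Descending N) (gapLists₃ k))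
      (sym (nextGap-4∣ (suc k * 4) (n∣m*n (suc k)))) (enumerate-gap₃ k))

∣-∣-gap : ∀ {c a b} → b ≤ a → c ≤ ∣ a - b ∣ → b + c ≤ a
∣-∣-gap {c} {a} {b} b≤a c≤ = begin
  b + c         ≤⟨ +-monoʳ-≤ b c≤ ⟩
  b + ∣ a - b ∣ ≡⟨ cong (b +_) (m≤n⇒∣n-m∣≡n∸m b≤a) ⟩
  b + (a ∸ b)   ≡⟨ m+[n∸m]≡n b≤a ⟩
  a             ∎
  where open ≤-Reasoning

gap-∣-∣ : ∀ {c a b} → b + c ≤ a → c ≤ ∣ a - b ∣
gap-∣-∣ {c} {a} {b} b+c≤a =
  subst (c ≤_) (sym (m≤n⇒∣n-m∣≡n∸m (≤-trans (m≤m+n b c) b+c≤a)))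
    (m+n≤o⇒m≤o∸n c (subst (_≤ a) (+-comm b c) b+c≤a))


<∸⇒+< : ∀ c {a b} → b < a ∸ c → b + c < a
<∸⇒+< zero    {a}     {b} b<a = subst (_< a) (sym (+-identityʳ b)) b<a
<∸⇒+< (suc c) {suc a} {b} b<  = subst (_< suc a) (sym (+-suc b c)) (s<s (<∸⇒+< c b<))

+<⇒<∸ : ∀ c {a b} → b + c < a → b < a ∸ c
+<⇒<∸ c {a} {b} = m+n≤o⇒m≤o∸n (suc b)

<nextGap⇒4-gap : ∀ {a b} → Odd a ⊎ 4 ∣ a → b < nextGap a → b + 4 ≤ a
<nextGap⇒4-gap {a} {b} (inj₁ odd) b< =
  subst (_≤ a) (sym (+-suc b 3)) (<∸⇒+< 3 (subst (b <_) (nextGap-odd a odd) b<))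
<nextGap⇒4-gap {a} {b} (inj₂ 4∣a) b< =
  <⇒≤ (<∸⇒+< 4 (subst (b <_) (nextGap-4∣ a 4∣a) b<))

<nextGap⇒8-gap : ∀ {a b} → b < nextGap a → 4 ∣ a → 4 ∣ b → b + 8 ≤ a
<nextGap⇒8-gap b< 4∣a@(divides i refl) (divides j refl) = begin
  j * 4 + 8     ≡⟨ +-comm (j * 4) 8 ⟩
  (2 + j) * 4   ≤⟨ *-monoˡ-≤ 4 (*-cancelʳ-< 4 (suc j) i 4+j*4<i*4) ⟩
  i * 4         ∎
  where
  open ≤-Reasoning
  4+j*4<i*4 : suc j * 4 < i * 4
  4+j*4<i*4 = subst (_< i * 4) (+-comm (j * 4) 4)
    (<∸⇒+< 4 (subst (j * 4 <_) (nextGap-4∣ (i * 4) 4∣a) b<))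

-- If a is a multiple of 4 then b = a - 4 would be one too, and the last hypothesis
-- excludes it.
gaps⇒<nextGap : ∀ {a b} → Odd a ⊎ 4 ∣ a → b + 4 ≤ a →
  (4 ∣ a → 4 ∣ b → 8 ≤ ∣ a - b ∣) → b < nextGap a
gaps⇒<nextGap {a} {b} (inj₁ odd) b+4≤a _ =
  subst (b <_) (sym (nextGap-odd a odd)) (+<⇒<∸ 3 (subst (_≤ a) (+-suc b 3) b+4≤a))
gaps⇒<nextGap {a} {b} (inj₂ 4∣a) b+4≤a far =
  subst (b <_) (sym (nextGap-4∣ a 4∣a)) (+<⇒<∸ 4 (≤∧≢⇒< b+4≤a b+4≢a))
  where
  b+4≢a : b + 4 ≢ a
  b+4≢a refl = contradiction (+-cancelˡ-≤ b 8 4 (∣-∣-gap (m≤m+n b 4) (far 4∣a 4∣b)))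
    λ { (s≤s (s≤s (s≤s (s≤s ())))) }
    where
    4∣b : 4 ∣ b
    4∣b = ∣m+n∣m⇒∣n (subst (4 ∣_) (+-comm b 4) 4∣a) ∣-refl

-- Mapping over the pairs of a list, with a property of the earlier element of
-- each pair at hand.
mapAllPairs : ∀ {P : ℕ → Set} {R S : ℕ → ℕ → Set} {l} →
  (∀ {a b} → P a → R a b → S a b) → All P l → AllPairs R l → AllPairs S l
mapAllPairs f []       []       = []
mapAllPairs f (p ∷ ps) (r ∷ rs) = All.map (f p) r ∷ mapAllPairs f ps rs

gapPartition⇒descending : ∀ {n N l} → n < N →
  GapPartition n l → GapParts.Descending N l × sum l ≡ n
gapPartition⇒descending n<N g =
  GapParts.descending (All.zip (positive , odd-or-4∣)) (sum<⇒parts< sums-to n<N)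
    (mapAllPairs (λ kind (b+4≤a , far) → gaps⇒<nextGap kind b+4≤a far)
      odd-or-4∣ (AllPairs.zip (4-gaps , multiples-gap)))
  , sums-to
  where
  open GapPartition g
  open IsPartition isPartition
  4-gaps = Linked⇒AllPairs
    (λ {a} {b} b+4≤a c+4≤b → ≤-trans c+4≤b (≤-trans (m≤m+n b 4) b+4≤a))
    (Linked.zipWith (λ (a≥b , 4≤) → ∣-∣-gap a≥b 4≤) (nonincreasing , consecutive-gap))

descending⇒gapPartition : ∀ {n N l} →
  GapParts.Descending N l → sum l ≡ n → GapPartition n l
descending⇒gapPartition {l = l} (GapParts.descending ps _ gs) eq = record
  { isPartition = record
    { positive      = All.map proj₁ ps
    ; nonincreasing = AllPairs⇒Linked (AllPairs.map <⇒≤ descent)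
    ; sums-to       = eq
    }
  ; distinct        = AllPairs.map >⇒≢ descent
  ; odd-or-4∣       = All.map proj₂ ps
  ; consecutive-gap = AllPairs⇒Linked (AllPairs.map gap-∣-∣ 4-gaps)
  ; multiples-gap   = AllPairs.map
      (λ b< 4∣a 4∣b → gap-∣-∣ (<nextGap⇒8-gap b< 4∣a 4∣b)) gs
  }
  where
  4-gaps : AllPairs (λ a b → b + 4 ≤ a) l
  4-gaps = mapAllPairs (<nextGap⇒4-gap ∘ proj₂) ps gs
  descent : AllPairs _>_ l
  descent = AllPairs.map (λ {a} {b} b+4≤a → <-≤-trans (m<m+n b z<s) b+4≤a) 4-gaps

-- Counting the lists

module Totals (φ : ℕ → ℕ) where

  open Weighted φ

  -- The functional of the generating function, in the sum of the entries, of a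
  -- list of partitions.
  total : ℕ → List (List ℕ) → ℕ
  total s L = sum (map (λ l → φ (s + sum l)) L)

  total-extend : ∀ s a L T → total s (L ++ map (a ∷_) T) ≡ total s L + total (s + a) T
  total-extend s a L T = begin
    total s (L ++ map (a ∷_) T)
      ≡⟨ cong sum (map-++ f L (map (a ∷_) T)) ⟩
    sum (map f L ++ map f (map (a ∷_) T))
      ≡⟨ sum-++ (map f L) _ ⟩
    total s L + sum (map f (map (a ∷_) T))
      ≡⟨ cong (λ ns → total s L + sum ns)
           (trans (sym (map-∘ T)) (map-cong (λ l → cong φ (sym (+-assoc s a (sum l)))) T)) ⟩
    total s L + total (s + a) T ∎
    where
    open ≡-Reasoning
    f = λ l → φ (s + sum l)

  total-empty : ∀ s → total s ([] ∷ []) ≡ φ s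
  total-empty s = trans (+-identityʳ _) (cong φ (+-identityʳ s))

  total-odd : ∀ k s → total s (oddLists k) ≡ odds 0 k s
  total-odd zero    s = total-empty s
  total-odd (suc k) s = trans (total-extend s _ (oddLists k) _)
    (cong₂ _+_ (total-odd k s) (total-odd k _))

  mutual

    total-gap₁ : ∀ k s → total s (gapLists₁ k) ≡ gap₁ 0 k s
    total-gap₁ zero    s = total-empty s
    total-gap₁ (suc k) s = trans (total-extend s _ (gapLists₄ k) _)
      (cong₂ _+_ (total-gap₄ k s) (total-gap₁ k _))

    total-gap₃ : ∀ k s → total s (gapLists₃ k) ≡ gap₃ 0 k s
    total-gap₃ zero    s = total-empty s
    total-gap₃ (suc k) s = trans (total-extend s _ (gapLists₁ (suc k)) _)
      (cong₂ _+_ (total-gap₁ (suc k) s) (total-gap₃ k _))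

    total-gap₄ : ∀ k s → total s (gapLists₄ k) ≡ gap₄ 0 k s
    total-gap₄ zero    s = total-empty s
    total-gap₄ (suc k) s = trans (total-extend s _ (gapLists₃ (suc k)) _)
      (cong₂ _+_ (total-gap₃ (suc k) s) (total-gap₃ k _))

-- The indicator of n: its functionals extract the coefficient of q^n.
indicator : ℕ → ℕ → ℕ
indicator n s = if does (s ≟ n) then 1 else 0

indicator-vanish : ∀ n {s} → suc n ≤ s → indicator n s ≡ 0
indicator-vanish n {s} n<s =
  cong (if_then 1 else 0) (dec-false (s ≟ n) (>⇒≢ n<s))

sum-indicator : ∀ n L →
  sum (map (λ l → indicator n (sum l)) L) ≡ length (filter (λ l → sum l ≟ n) L)
sum-indicator n []      = refl
sum-indicator n (l ∷ L) with does (sum l ≟ n)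
... | true  = cong suc (sum-indicator n L)
... | false = sum-indicator n L

-- The truncation bound n + 1 is at most 4(n + 1), as required by the choice of
-- k = n + 1.
equinumerous : ∀ n →
  length (filter (λ l → sum l ≟ n) (gapLists₄ (suc n)))
    ≡ length (filter (λ l → sum l ≟ n) (oddLists (suc n * 2)))
equinumerous n = begin
  length (filter (λ l → sum l ≟ n) (gapLists₄ (suc n)))
    ≡⟨ sum-indicator n (gapLists₄ (suc n)) ⟨
  total 0 (gapLists₄ (suc n))
    ≡⟨ total-gap₄ (suc n) 0 ⟩
  gap₄ 0 (suc n) 0
    ≡⟨ gap₄≡odds 0 (suc n) (m≤m*n (suc n) 4) 0 ⟩
  odds 0 (suc n * 2) 0
    ≡⟨ total-odd (suc n * 2) 0 ⟨
  total 0 (oddLists (suc n * 2))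
    ≡⟨ sum-indicator n (oddLists (suc n * 2)) ⟩
  length (filter (λ l → sum l ≟ n) (oddLists (suc n * 2))) ∎
  where
  open ≡-Reasoning
  open Totals (indicator n)
  open Weighted (indicator n)
  open Vanishing (suc n) (indicator-vanish n)

theorem1p3 : (n : ℕ) → 0 < n →
    ∃[ k ] HasCardinality (DistinctOdd n) k × HasCardinality (GapPartition n) k
theorem1p3 n _ = _
  , enumerate-filter (enumerate-odd (suc n * 2))
      (distinctOdd⇒descending (m≤n⇒m≤n*o 2 (m≤m*n (suc n) 2))) descending⇒distinctOdd
  , subst (HasCardinality (GapPartition n)) (equinumerous n)
      (enumerate-filter (enumerate-gap₄ (suc n))
        (gapPartition⇒descending (m≤n⇒m≤1+n (m≤m*n (suc n) 4))) descending⇒gapPartition)
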